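{- Let $G$ be a finite loopless graph on $n$ vertices with $c$ connected components. The maximal number of colors used in a Gallai coloring of $G$ is $n-c$.
   Context: A Gallai coloring of a graph $G=(V,E)$ is a function $\varepsilon$ from $E$ to a set of colors such that no cycle of $G$ is rainbow, i.e. on every cycle at least two edges have the same color (equivalently, for every circuit $X$ of the graphic matroid of $G$, $|\varepsilon(X)|<|X|$). The number of colors used is $|\varepsilon(E)|$. -}

module Defs where

open import Level using (0ℓ)
open import Data.Nat.Base using (ℕ; suc; _≤_)
open import Data.Fin.Base using (Fin; zero; suc; inject₁; fromℕ)
open import Data.Product.Base using (Σ-syntax; ∃-syntax; _×_; _,_; proj₁; proj₂)
open import Data.Sum.Base using (_⊎_; swap)
open import Function.Base using (_∘_)
open import Function.Bundles using (Bijection)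
open import Function.Definitions using (Injective)
open import Relation.Binary.Bundles using (Setoid)
open import Relation.Binary.Core using (Rel)
import Relation.Binary.Construct.On as On
open import Relation.Binary.Construct.Closure.ReflexiveTransitive
  using (Star; ε; _◅◅_; reverse)
open import Relation.Binary.PropositionalEquality using (_≡_; _≢_; setoid)
open import Relation.Nullary.Negation using (¬_)

-- Parallel edges are allowed.  The order of the two ends of an edge carries no
-- meaning: everything below depends on it only through the symmetric `Joins`.
record Graph (n m : ℕ) : Set where
  field
    ends : Fin m → Fin n × Fin n

  Joins : Fin m → Fin n → Fin n → Set
  Joins e u v = ends e ≡ (u , v) ⊎ ends e ≡ (v , u)

  Loopless : Set
  Loopless = ∀ e → proj₁ (ends e) ≢ proj₂ (ends e)

  Adjacent : Rel (Fin n) 0ℓ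
  Adjacent u v = ∃[ e ] Joins e u v

  -- The vertices up to being joined by a walk, so that the elements of this
  -- setoid are the connected components.
  components : Setoid 0ℓ 0ℓ
  components = record
    { Carrier       = Fin n
    ; _≈_           = Star Adjacent
    ; isEquivalence = record
      { refl  = ε
      ; sym   = reverse λ (e , j) → e , swap j
      ; trans = _◅◅_
      }
    }

  -- v₀ -e₀- v₁ -e₁- ⋯ -eₖ₋₁- vₖ -eₖ- v₀, of length k + 1, without repeated
  -- vertices or edges.  Length 2 is a pair of parallel edges (distinctness of
  -- the edges rules out going back along the same one), length 1 is a loop.
  record Cycle : Set where
    field
      {k}              : ℕ
      vertex           : Fin (suc k) → Fin n
      edge             : Fin (suc k) → Fin m
      vertex-injective : Injective _≡_ _≡_ vertex
      edge-injective   : Injective _≡_ _≡_ edge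
      joins            : ∀ (i : Fin k) →
                         Joins (edge (inject₁ i)) (vertex (inject₁ i)) (vertex (suc i))
      closes           : Joins (edge (fromℕ k)) (vertex (fromℕ k)) (vertex zero)

  Rainbow : {C : Set} → (Fin m → C) → Cycle → Set
  Rainbow col X = Injective _≡_ _≡_ (col ∘ Cycle.edge X)

  IsGallai : {C : Set} → (Fin m → C) → Set
  IsGallai col = ∀ X → ¬ Rainbow col X

HasCardinality : Setoid 0ℓ 0ℓ → ℕ → Set
HasCardinality S k = Bijection S (setoid (Fin k))

-- Elements of the image are compared as elements of the codomain, ignoring the
-- chosen preimage.
image : {A B : Set} → (A → B) → Setoid 0ℓ 0ℓ
image {B = B} f = On.setoid {B = ∃[ b ] ∃[ a ] f a ≡ b} (setoid B) proj₁

HasGallaiColoringWith : ∀ {n m} → Graph n m → ℕ → Set₁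
HasGallaiColoringWith {m = m} G k =
  Σ[ C ∈ Set ] Σ[ col ∈ (Fin m → C) ]
    Graph.IsGallai G col × HasCardinality (image col) k

IsMaximum : (ℕ → Set₁) → ℕ → Set₁
IsMaximum P k = P k × (∀ j → P j → j ≤ k)

{-# OPTIONS --safe #-}

-- Insert the edges one at a time and keep track of the connected components by
-- a labelling of the vertices, merging two labels whenever an edge joins them.
--
-- Upper bound: one edge of each colour gives a set of edges containing no
-- cycle, because such a cycle would be rainbow.  Hence every one of them merges
-- two labels, and at least c labels remain.
--
-- Lower bound: colour an edge by the time at which its ends get the same label.
-- On a cycle, the edges of the latest colour t are those whose ends have
-- different labels just before time t, and a closed walk cannot change label
-- exactly once.  Every merge uses one new colour, and exactly c labels remain.

module Submission where

open import Data.Bool.Base using (if_then_else_)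
open import Data.Empty using (⊥-elim)
open import Data.Fin.Base using (Fin; zero; suc; inject₁; fromℕ; fromℕ<; toℕ; punchOut; punchIn)
open import Data.Fin.Properties
  using (_≟_; suc-injective; any?; punchOut-cong; punchOut-injective; punchOut-punchIn;
         punchInᵢ≢i; injective⇒≤; fromℕ<-cong; fromℕ<-injective; toℕ<n; fromℕ<-toℕ)
open import Data.List.Base using (List; []; _∷_; length; tabulate; allFin)
open import Data.List.Membership.Propositional using (_∈_; _∉_)
open import Data.List.Membership.Propositional.Properties using (∈-tabulate⁻; ∈-allFin)
open import Data.List.Properties using (length-tabulate)
import Data.List.Relation.Unary.All as All
open import Data.List.Relation.Unary.AllPairs using (_∷_)
open import Data.List.Relation.Unary.Any using (here; there)
open import Data.List.Relation.Unary.Unique.Propositional using (Unique)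
open import Data.List.Relation.Unary.Unique.Propositional.Properties using (tabulate⁺)
open import Data.Nat.Base using (ℕ; zero; suc; _+_; _∸_; _≤_; _<_; s≤s)
open import Data.Nat.Properties
  using (≤-antisym; ≤-reflexive; <⇒≤; m<1+n⇒m<n∨m≡n;
         +-suc; m+n∸n≡m; ∸-monoʳ-≤; module ≤-Reasoning)
open import Data.Product.Base using (Σ-syntax; ∃-syntax; _×_; _,_; proj₁; proj₂; map₂; uncurry)
open import Data.Sum.Base using (_⊎_; inj₁; inj₂; swap)
open import Function.Base using (_∘_; id)
open import Function.Bundles using (Bijection)
open import Function.Definitions using (Injective; StrictlySurjective)
open import Relation.Binary.Construct.Closure.ReflexiveTransitive
  using (Star; ε; _◅_; _◅◅_; reverse)
import Relation.Binary.Construct.Closure.ReflexiveTransitive as Star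
open import Relation.Binary.PropositionalEquality
  using (_≡_; _≢_; refl; sym; trans; cong; subst; module ≡-Reasoning)
open import Relation.Nullary using (¬_; Dec; yes; no; does; contradiction)
open import Relation.Nullary.Decidable using (decidable-stable; dec-true; dec-false)
open import Defs

-- Identification of labels, closed sequences, and images of finite size

private
  variable
    n m k t : ℕ

-- Sends a to the image of b, and is injective otherwise.
collapse : {a b : Fin (suc k)} → a ≢ b → Fin (suc k) → Fin k
collapse {a = a} a≢b x with a ≟ x
... | yes _  = punchOut a≢b
... | no a≢x = punchOut a≢x

collapse-≡ : {a b : Fin (suc k)} (a≢b : a ≢ b) → collapse a≢b a ≡ collapse a≢b b
collapse-≡ {a = a} {b} a≢b with a ≟ a | a ≟ b
... | _      | yes a≡b = contradiction a≡b a≢b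
... | no a≢a | no _    = contradiction refl a≢a
... | yes _  | no _    = punchOut-cong a refl

-- Only `a` and `b` acquire a common image. The two mixed cases stay apart because `merge` crosses
-- the new edge in opposite directions in them.
collapse-injective : {a b : Fin (suc k)} (a≢b : a ≢ b) {x y : Fin (suc k)} →
  collapse a≢b x ≡ collapse a≢b y → x ≡ y ⊎ (a ≡ x × b ≡ y) ⊎ (a ≡ y × b ≡ x)
collapse-injective {a = a} a≢b {x} {y} eq with a ≟ x | a ≟ y
... | yes a≡x | yes a≡y = inj₁ (trans (sym a≡x) a≡y)
... | yes a≡x | no a≢y  = inj₂ (inj₁ (a≡x , punchOut-injective a≢b a≢y eq))
... | no a≢x  | yes a≡y = inj₂ (inj₂ (a≡y , punchOut-injective a≢b a≢x (sym eq)))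
... | no a≢x  | no a≢y  = inj₁ (punchOut-injective a≢x a≢y eq)

collapse-punchIn : {a b : Fin (suc k)} (a≢b : a ≢ b) (y : Fin k) →
  collapse a≢b (punchIn a y) ≡ y
collapse-punchIn {a = a} a≢b y with a ≟ punchIn a y
... | yes a≡ = contradiction (sym a≡) (punchInᵢ≢i a y)
... | no a≢  = trans (punchOut-cong a refl) (punchOut-punchIn a)

constant-steps : {A : Set} (g : Fin (suc k) → A) →
  (∀ i → g (inject₁ i) ≡ g (suc i)) → g zero ≡ g (fromℕ k)
constant-steps {zero}  g step = refl
constant-steps {suc k} g step = trans (step zero) (constant-steps (g ∘ suc) (step ∘ suc))

-- P i says that the closed sequence g 0, …, g k, a does not change at its
-- i-th step.
closed-changes-twice : {A : Set} {a : A} (g : Fin (suc k) → A) (P : Fin (suc k) → Set) →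
  (∀ i → P (inject₁ i) → g (inject₁ i) ≡ g (suc i)) →
  (∀ i → g (inject₁ i) ≡ g (suc i) → P (inject₁ i)) →
  (P (fromℕ k) → g (fromℕ k) ≡ a) →
  (g (fromℕ k) ≡ a → P (fromℕ k)) →
  g zero ≡ a →
  ∀ i → (∀ j → j ≢ i → P j) → P i
closed-changes-twice {zero}  g P to from toₖ fromₖ g₀≡a zero    _      = fromₖ g₀≡a
closed-changes-twice {suc k} g P to from toₖ fromₖ g₀≡a zero    others =
  from zero (trans g₀≡a (sym (trans
    (constant-steps (g ∘ suc) λ i → to (suc i) (others (suc (inject₁ i)) λ ()))
    (toₖ (others (suc (fromℕ k)) λ ())))))
-- Step 0 leaves the value unchanged, so the sequence without its first term still closes up at `a`.
-- This is why `a` is kept separate from `g zero`.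
closed-changes-twice {suc k} g P to from toₖ fromₖ g₀≡a (suc i) others =
  closed-changes-twice (g ∘ suc) (P ∘ suc) (to ∘ suc) (from ∘ suc) toₖ fromₖ
    (trans (sym (to zero (others zero λ ()))) g₀≡a)
    i (λ j j≢i → others (suc j) (j≢i ∘ suc-injective))

image-below-cardinality : {A : Set} (f : A → ℕ) →
  (∀ x → f x < t) → (∀ {s} → s < t → ∃[ x ] f x ≡ s) → HasCardinality (image f) t
image-below-cardinality {t} f f<t onto = record
  { to        = to
  ; cong      = λ {x} {y} eq → fromℕ<-cong _ _ eq (below x) (below y)
  ; bijective = (λ {x} {y} → fromℕ<-injective _ _ (below x) (below y))
              , λ s → (toℕ s , onto (toℕ<n s))
              , λ {z} z≡s → trans (fromℕ<-cong _ _ z≡s (below z) (toℕ<n s)) (fromℕ<-toℕ s (toℕ<n s))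
  }
  where
  below : (y : ∃[ b ] ∃[ x ] f x ≡ b) → proj₁ y < t
  below (_ , x , refl) = f<t x
  to : ∃[ b ] ∃[ x ] f x ≡ b → Fin t
  to y = fromℕ< (below y)

-- Walks along a list of edges

module _ (G : Graph n m) where
  open Graph G

  Via : List (Fin m) → Fin n → Fin n → Set
  Via es u v = ∃[ e ] e ∈ es × Joins e u v

  Walk : List (Fin m) → Fin n → Fin n → Set
  Walk es = Star (Via es)

  Via-sym : ∀ {es u v} → Via es u v → Via es v u
  Via-sym (e , e∈ , j) = e , e∈ , swap j

  weaken : ∀ {es e u v} → Walk es u v → Walk (e ∷ es) u v
  weaken = Star.map λ (e , e∈ , j) → e , there e∈ , j

  Joins-end : ∀ {e a b c d} → Joins e a b → Joins e c d → a ≡ c ⊎ a ≡ d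
  Joins-end (inj₁ p) (inj₁ q) = inj₁ (cong proj₁ (trans (sym p) q))
  Joins-end (inj₁ p) (inj₂ q) = inj₂ (cong proj₁ (trans (sym p) q))
  Joins-end (inj₂ p) (inj₁ q) = inj₂ (cong proj₂ (trans (sym p) q))
  Joins-end (inj₂ p) (inj₂ q) = inj₁ (cong proj₂ (trans (sym p) q))

  -- Simple walks and the cycles they close up to

  steps : ∀ {es u v} → Walk es u v → ℕ
  steps ε       = 0
  steps (_ ◅ w) = suc (steps w)

  vertexAt : ∀ {es u v} (w : Walk es u v) → Fin (suc (steps w)) → Fin n
  vertexAt {u = u} _       zero    = u
  vertexAt         (_ ◅ w) (suc i) = vertexAt w i

  vertexAt-last : ∀ {es u v} (w : Walk es u v) → vertexAt w (fromℕ (steps w)) ≡ v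
  vertexAt-last ε       = refl
  vertexAt-last (_ ◅ w) = vertexAt-last w

  Simple : ∀ {es u v} → Walk es u v → Set
  Simple w = Injective _≡_ _≡_ (vertexAt w)

  simple-tail : ∀ {es u v x} {r : Via es u v} (w : Walk es v x) → Simple (r ◅ w) → Simple w
  simple-tail w inj = suc-injective ∘ inj

  simple-suffix : ∀ {es u v} (w : Walk es u v) → Simple w → (i : Fin (suc (steps w))) →
    Σ[ w′ ∈ Walk es (vertexAt w i) v ] Simple w′
  simple-suffix w       inj zero    = w , inj
  simple-suffix (_ ◅ w) inj (suc i) = simple-suffix w (simple-tail w inj) i

  simple-cons : ∀ {es u v x} (r : Via es u v) (w : Walk es v x) →
    (∀ i → vertexAt w i ≢ u) → Simple w → Simple (r ◅ w)
  simple-cons r w fresh inj {zero}  {zero}  _  = refl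
  simple-cons r w fresh inj {zero}  {suc j} eq = contradiction (sym eq) (fresh j)
  simple-cons r w fresh inj {suc i} {zero}  eq = contradiction eq (fresh i)
  simple-cons r w fresh inj {suc i} {suc j} eq = cong suc (inj eq)

  -- Once the tail is simple, a return to `u` is cut out by starting at that later visit; otherwise
  -- prepending `u` repeats nothing.
  erase-loops : ∀ {es u v} → Walk es u v → Σ[ w ∈ Walk es u v ] Simple w
  erase-loops ε = ε , λ { {zero} {zero} _ → refl }
  erase-loops {es} {u} {v} (r ◅ w) with erase-loops w
  ... | w′ , inj with any? (λ i → vertexAt w′ i ≟ u)
  ...   | yes (i , refl) = simple-suffix w′ inj i
  ...   | no ∄           = r ◅ w′ , simple-cons r w′ (λ i eq → ∄ (i , eq)) inj

  module _ (e : Fin m) where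

    -- The closing edge `e` takes the last index, after the edges of the walk, so that edges and
    -- vertices share one index set as in `Cycle`.
    edgeAt : ∀ {es u v} (w : Walk es u v) → Fin (suc (steps w)) → Fin m
    edgeAt ε              zero    = e
    edgeAt ((e′ , _) ◅ w) zero    = e′
    edgeAt (_ ◅ w)        (suc i) = edgeAt w i

    edgeAt-last : ∀ {es u v} (w : Walk es u v) → edgeAt w (fromℕ (steps w)) ≡ e
    edgeAt-last ε       = refl
    edgeAt-last (_ ◅ w) = edgeAt-last w

    edgeAt-joins : ∀ {es u v} (w : Walk es u v) (i : Fin (steps w)) →
      Joins (edgeAt w (inject₁ i)) (vertexAt w (inject₁ i)) (vertexAt w (suc i))
    edgeAt-joins ((_ , _ , j) ◅ w) zero    = j
    edgeAt-joins (_ ◅ w)           (suc i) = edgeAt-joins w i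

    edgeAt-∈ : ∀ {es u v} (w : Walk es u v) i → edgeAt w i ∈ e ∷ es
    edgeAt-∈ ε                  zero    = here refl
    edgeAt-∈ ((_ , e′∈ , _) ◅ w) zero    = there e′∈
    edgeAt-∈ (_ ◅ w)            (suc i) = edgeAt-∈ w i

    edgeAt-ends : ∀ {es u v} (w : Walk es u v) i →
      edgeAt w i ≡ e ⊎ (∃[ a ] ∃[ b ] Joins (edgeAt w i) (vertexAt w a) (vertexAt w b))
    edgeAt-ends ε                 zero    = inj₁ refl
    edgeAt-ends ((_ , _ , j) ◅ w) zero    = inj₂ (zero , suc zero , j)
    edgeAt-ends (_ ◅ w)           (suc i) with edgeAt-ends w i
    ... | inj₁ eq          = inj₁ eq
    ... | inj₂ (a , b , j) = inj₂ (suc a , suc b , j)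

    module _ {es} (e∉es : e ∉ es) where

      -- The first edge has `u` as an end. If it recurred among the edges of `w`, then `u` would be
      -- a vertex of `w`, against simplicity; it is not the closing edge because `e∉es`.
      edgeAt-fresh : ∀ {u v x} (r : Via es u v) (w : Walk es v x) → Simple (r ◅ w) →
        ∀ i → proj₁ r ≢ edgeAt w i
      edgeAt-fresh (_ , e′∈ , j) w inj i refl with edgeAt-ends w i
      ... | inj₁ eq = e∉es (subst (_∈ es) eq e′∈)
      ... | inj₂ (a , b , j′) with Joins-end j j′
      ...   | inj₁ u≡ = contradiction (inj {zero} {suc a} u≡) λ ()
      ...   | inj₂ u≡ = contradiction (inj {zero} {suc b} u≡) λ ()

      edgeAt-injective : ∀ {u v} (w : Walk es u v) → Simple w → Injective _≡_ _≡_ (edgeAt w)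
      edgeAt-injective ε       inj {zero}  {zero}  _  = refl
      edgeAt-injective (r ◅ w) inj {zero}  {zero}  _  = refl
      edgeAt-injective (r ◅ w) inj {zero}  {suc j} eq = contradiction eq (edgeAt-fresh r w inj j)
      edgeAt-injective (r ◅ w) inj {suc i} {zero}  eq = contradiction (sym eq) (edgeAt-fresh r w inj i)
      edgeAt-injective (r ◅ w) inj {suc i} {suc j} eq =
        cong suc (edgeAt-injective w (simple-tail w inj) eq)

      -- In a simple walk no edge repeats either, so `e` closes it to a cycle. If `u` and `v`
      -- coincide, this cycle is the loop `e`.
      close-walk : ∀ {u v} → Joins e v u → Walk es u v →
        Σ[ X ∈ Cycle ] (∀ i → Cycle.edge X i ∈ e ∷ es)
      close-walk {u} j w₀ with erase-loops w₀
      ... | w , inj = record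
        { vertex           = vertexAt w
        ; edge             = edgeAt w
        ; vertex-injective = inj
        ; edge-injective   = edgeAt-injective w inj
        ; joins            = edgeAt-joins w
        ; closes           = closes
        } , edgeAt-∈ w
        where
        closes : Joins (edgeAt w (fromℕ (steps w))) (vertexAt w (fromℕ (steps w))) u
        closes rewrite edgeAt-last w | vertexAt-last w = j

  -- Labellings of the components

  Inner : (Fin n → Fin k) → Fin m → Set
  Inner f e = f (proj₁ (ends e)) ≡ f (proj₂ (ends e))

  inner? : (f : Fin n → Fin k) (e : Fin m) → Dec (Inner f e)
  inner? f e = f (proj₁ (ends e)) ≟ f (proj₂ (ends e))

  Inner⇒≡ : ∀ {e u v} (f : Fin n → Fin k) → Joins e u v → Inner f e → f u ≡ f v
  Inner⇒≡ f (inj₁ refl) eq = eq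
  Inner⇒≡ f (inj₂ refl) eq = sym eq

  ≡⇒Inner : ∀ {e u v} (f : Fin n → Fin k) → Joins e u v → f u ≡ f v → Inner f e
  ≡⇒Inner f (inj₁ refl) eq = eq
  ≡⇒Inner f (inj₂ refl) eq = sym eq

  -- Names for the components of the subgraph with edges `es`: `label-inner` makes labels constant
  -- on components, `label-connected` separates different components, and `label-onto` makes `k`
  -- their exact number.
  record Labelling (es : List (Fin m)) (k : ℕ) : Set where
    field
      label           : Fin n → Fin k
      label-onto      : StrictlySurjective _≡_ label
      label-connected : ∀ {u v} → label u ≡ label v → Walk es u v
      label-inner     : ∀ {e} → e ∈ es → Inner label e

  open Labelling

  discrete : Labelling [] n
  discrete = record
    { label           = id
    ; label-onto      = λ u → u , refl
    ; label-connected = λ { refl → ε }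
    ; label-inner     = λ ()
    }

  skip : ∀ {es e} (L : Labelling es k) → Inner (label L) e → Labelling (e ∷ es) k
  skip L inner = record
    { label           = label L
    ; label-onto      = label-onto L
    ; label-connected = weaken ∘ label-connected L
    ; label-inner     = λ { (here refl) → inner ; (there e∈) → label-inner L e∈ }
    }

  merge : ∀ {es e} (L : Labelling es (suc k)) → ¬ Inner (label L) e → Labelling (e ∷ es) k
  merge {es = es} {e} L outer = record
    { label           = collapse outer ∘ label L
    ; label-onto      = λ y → map₂ (λ eq → trans (cong (collapse outer) eq) (collapse-punchIn outer y))
                                   (label-onto L (punchIn _ y))
    ; label-connected = λ eq → connected (collapse-injective outer eq)
    ; label-inner     = λ { (here refl) → collapse-≡ outer
                          ; (there e∈)  → cong (collapse outer) (label-inner L e∈) }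
    }
    where
    through : ∀ {x y} → label L (proj₁ (ends e)) ≡ label L x → label L (proj₂ (ends e)) ≡ label L y →
      Walk (e ∷ es) x y
    through p q = weaken (label-connected L (sym p))
      ◅◅ (e , here refl , inj₁ refl) ◅ weaken (label-connected L q)

    connected : ∀ {x y} → _ → Walk (e ∷ es) x y
    connected (inj₁ eq)             = weaken (label-connected L eq)
    connected (inj₂ (inj₁ (p , q))) = through p q
    connected (inj₂ (inj₂ (p , q))) = reverse Via-sym (through p q)

  -- Number of labels against number of components

  module _ {c : ℕ} (card : HasCardinality components c) where
    private module B = Bijection card

    -- Representatives of different components have different labels, since a walk along `es` is a
    -- walk in the whole graph.
    component-count-≤ : ∀ {es} → Labelling es k → c ≤ k
    component-count-≤ {k} L = injective⇒≤ {f = label L ∘ proj₁ ∘ B.strictlySurjective} λ {a} {b} eq →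
      trans (sym (proj₂ (B.strictlySurjective a)))
        (trans (B.cong (Star.map (map₂ proj₂) (label-connected L eq)))
          (proj₂ (B.strictlySurjective b)))

    label-respects : ∀ {f : Fin n → Fin k} → (∀ e → Inner f e) →
      ∀ {u v} → Star Adjacent u v → f u ≡ f v
    label-respects         inner ε             = refl
    label-respects {f = f} inner ((e , j) ◅ w) =
      trans (Inner⇒≡ f j (inner e)) (label-respects inner w)

    -- With every edge inserted, labels are constant along all walks, so vertices chosen for
    -- different labels lie in different components.
    component-count-≡ : Labelling (allFin m) k → k ≡ c
    component-count-≡ {k} L = ≤-antisym
      (injective⇒≤ {f = B.to ∘ proj₁ ∘ label-onto L} λ {a} {b} eq →
        trans (sym (proj₂ (label-onto L a)))
          (trans (label-respects {f = label L} (λ e → label-inner L (∈-allFin e)) (B.injective eq))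
            (proj₂ (label-onto L b))))
      (component-count-≤ L)

  -- Upper bound

  -- Every inserted edge must merge two labels, so each step trades one label for one edge.
  forest-labelling : ∀ es → Unique es → (∀ X → ¬ (∀ i → Cycle.edge X i ∈ es)) →
    ∃[ k ] Labelling es k × length es + k ≡ n
  forest-labelling []       _             _       = _ , discrete , refl
  forest-labelling (e ∷ es) (e∉ ∷ unique) acyclic
    with forest-labelling es unique (λ X X⊆ → acyclic X (there ∘ X⊆))
  ... | k , L , size with inner? (label L) e
  -- Equal labels give a walk along `es` between the ends of `e`, which `e` closes to a forbidden
  -- cycle.
  ...   | yes inner = contradiction (label-connected L (sym inner))
    (uncurry acyclic ∘ close-walk e (λ e∈ → All.lookup e∉ e∈ refl) (inj₁ refl))
  -- With no labels there could be no vertices, yet `e` has ends.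
  forest-labelling (e ∷ es) _ _ | zero  , L , size | no _ with () ← label L (proj₁ (ends e))
  forest-labelling (e ∷ es) _ _ | suc k , L , size | no outer =
    k , merge L outer , trans (sym (+-suc (length es) k)) size

  colours-≤ : ∀ {c j} → HasCardinality components c → HasGallaiColoringWith G j → j ≤ n ∸ c
  colours-≤ {c} {j} card (C , col , gallai , bij) = bound (forest-labelling es (tabulate⁺ rep-injective) acyclic)
    where
    module B = Bijection bij

    sample : Fin j → ∃[ b ] ∃[ e ] col e ≡ b
    sample = proj₁ ∘ B.strictlySurjective

    rep : Fin j → Fin m
    rep = proj₁ ∘ proj₂ ∘ sample

    col-rep : ∀ s → col (rep s) ≡ proj₁ (sample s)
    col-rep = proj₂ ∘ proj₂ ∘ sample

    -- Equal colours are equal elements of `image col`, whichever edges realise them, so they have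
    -- the same index.
    col-rep-injective : Injective _≡_ _≡_ (col ∘ rep)
    col-rep-injective {s} {t} eq = begin
      s               ≡⟨ proj₂ (B.strictlySurjective s) ⟨
      B.to (sample s) ≡⟨ B.cong (trans (sym (col-rep s)) (trans eq (col-rep t))) ⟩
      B.to (sample t) ≡⟨ proj₂ (B.strictlySurjective t) ⟩
      t               ∎
      where open ≡-Reasoning

    rep-injective : Injective _≡_ _≡_ rep
    rep-injective = col-rep-injective ∘ cong col

    es : List (Fin m)
    es = tabulate rep

    acyclic : ∀ X → ¬ (∀ i → Cycle.edge X i ∈ es)
    -- All edges of `X` are representatives, so two of the same colour are the same edge.
    acyclic X X⊆ = gallai X λ {a} {b} → rainbow (∈-tabulate⁻ (X⊆ a)) (∈-tabulate⁻ (X⊆ b))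
      where
      open Cycle X
      rainbow : ∀ {a b} → ∃[ s ] edge a ≡ rep s → ∃[ t ] edge b ≡ rep t →
        col (edge a) ≡ col (edge b) → a ≡ b
      rainbow (s , p) (t , q) eq = edge-injective (trans p (trans
        (cong rep (col-rep-injective (trans (sym (cong col p)) (trans eq (cong col q))))) (sym q)))

    bound : ∃[ k ] Labelling es k × length es + k ≡ n → j ≤ n ∸ c
    bound (k , L , size) = begin
      j                   ≡⟨ length-tabulate rep ⟨
      length es           ≡⟨ m+n∸n≡m (length es) k ⟨
      length es + k ∸ k   ≡⟨ cong (_∸ k) size ⟩
      n ∸ k               ≤⟨ ∸-monoʳ-≤ n (component-count-≤ card L) ⟩
      n ∸ c               ∎
      where open ≤-Reasoning

  -- Lower bound

  -- The labels read around the cycle form a closed sequence, and an edge is inner exactly where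
  -- this sequence does not change.
  cycle-outer-twice : (f : Fin n → Fin k) (X : Cycle) (i : _) →
    (∀ j → j ≢ i → Inner f (Cycle.edge X j)) → Inner f (Cycle.edge X i)
  cycle-outer-twice f X = closed-changes-twice (f ∘ vertex) (Inner f ∘ edge)
    (Inner⇒≡ f ∘ joins) (≡⇒Inner f ∘ joins) (Inner⇒≡ f closes) (≡⇒Inner f closes) refl
    where open Cycle X

  -- The colouring by merge times after t merges, the edges whose ends are still
  -- apart having the provisional colour t.
  record MergeColouring (f : Fin n → Fin k) (t : ℕ) : Set where
    field
      colour  : Fin m → ℕ
      inner-< : ∀ {e} → Inner f e → colour e < t
      outer-≡ : ∀ {e} → ¬ Inner f e → colour e ≡ t
      used    : ∀ {s} → s < t → ∃[ e ] Inner f e × colour e ≡ s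
      gallai  : ∀ X → (∀ i → Inner f (Cycle.edge X i)) → ¬ Rainbow colour X

  -- Under the identity labelling an inner edge is a loop, so every edge starts as outer.
  initial : Loopless → MergeColouring id 0
  initial loopless = record
    { colour  = λ _ → 0
    ; inner-< = λ {e} → ⊥-elim ∘ loopless e
    ; outer-≡ = λ _ → refl
    ; used    = λ ()
    ; gallai  = λ X inner _ → loopless _ (inner zero)
    }

  -- Edges whose ends have just come together keep `t`, which thereby becomes final; only those
  -- still apart move on to `suc t`. The edge `e` witnesses that `t` is used.
  advance : ∀ {l} {f : Fin n → Fin k} {f′ : Fin n → Fin l} {e} →
    (∀ {e} → Inner f e → Inner f′ e) → ¬ Inner f e → Inner f′ e →
    MergeColouring f t → MergeColouring f′ (suc t)
  advance {t = t} {f = f} {f′} {e₀} coarser outer inner M = record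
    { colour  = colour′
    ; inner-< = λ {e} inn → s≤s (subst (_≤ t) (sym (kept inn)) (colour-≤ e))
    ; outer-≡ = λ {e} out → cong (if_then colour e else suc t) (dec-false (inner? f′ e) out)
    ; used    = used′
    ; gallai  = gallai′
    }
    where
    open MergeColouring M

    colour′ : Fin m → ℕ
    colour′ e = if does (inner? f′ e) then colour e else suc t

    kept : ∀ {e} → Inner f′ e → colour′ e ≡ colour e
    kept {e} inn = cong (if_then colour e else suc t) (dec-true (inner? f′ e) inn)

    colour-≤ : ∀ e → colour e ≤ t
    colour-≤ e with inner? f e
    ... | yes inn = <⇒≤ (inner-< inn)
    ... | no out  = ≤-reflexive (outer-≡ out)

    used′ : ∀ {s} → s < suc t → ∃[ e ] Inner f′ e × colour′ e ≡ s
    used′ s<1+t with m<1+n⇒m<n∨m≡n s<1+t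
    ... | inj₁ s<t with used s<t
    ...   | e , inn , eq = e , coarser inn , trans (kept (coarser inn)) eq
    used′ s<1+t | inj₂ refl = e₀ , inner , trans (kept inner) (outer-≡ outer)

    gallai′ : ∀ X → (∀ i → Inner f′ (Cycle.edge X i)) → ¬ Rainbow colour′ X
    gallai′ X inner′ rainbow′ = gallai X inn rainbow
      where
      open Cycle X
      rainbow : Rainbow colour X
      rainbow eq = rainbow′ (trans (kept (inner′ _)) (trans eq (sym (kept (inner′ _)))))

      -- An edge that was outer for `f` has colour `t`. Any other such edge of the cycle would share
      -- that colour, so in a rainbow cycle it would be the only one, which `cycle-outer-twice`
      -- excludes.
      inn : ∀ i → Inner f (edge i)
      inn i = decidable-stable (inner? f (edge i)) λ out → out (cycle-outer-twice f X i λ j j≢i →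
        decidable-stable (inner? f (edge j)) λ out′ →
          j≢i (rainbow (trans (outer-≡ out′) (sym (outer-≡ out)))))

  -- Here `t` counts merges rather than inserted edges; each merge trades one label for one new
  -- colour.
  merge-colouring : Loopless → ∀ es →
    ∃[ k ] ∃[ t ] Σ[ L ∈ Labelling es k ] MergeColouring (label L) t × t + k ≡ n
  merge-colouring loopless []       = _ , _ , discrete , initial loopless , refl
  merge-colouring loopless (e ∷ es) with merge-colouring loopless es
  ... | k , t , L , M , size with inner? (label L) e
  ...   | yes inner = k , t , skip L inner , M , size
  merge-colouring _ (e ∷ es) | zero  , t , L , M , size | no _ with () ← label L (proj₁ (ends e))
  merge-colouring _ (e ∷ es) | suc k , t , L , M , size | no outer =
    k , suc t , merge L outer
    , advance (cong (collapse outer)) outer (collapse-≡ outer) M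
    , trans (sym (+-suc t k)) size

  -- After all insertions every edge is inner, so no provisional colour remains and the colours are
  -- exactly the numbers below `t`.
  gallai-colouring : ∀ {c} → Loopless → HasCardinality components c → HasGallaiColoringWith G (n ∸ c)
  gallai-colouring {c} loopless card with merge-colouring loopless (allFin m)
  ... | k , t , L , M , size = subst (HasGallaiColoringWith G) t≡n∸c
    ( ℕ , colour , (λ X → gallai X λ _ → inner _)
    , image-below-cardinality colour (λ e → inner-< (inner e)) (map₂ proj₂ ∘ used) )
    where
    open MergeColouring M

    inner : ∀ e → Inner (label L) e
    inner e = label-inner L (∈-allFin e)

    t≡n∸c : t ≡ n ∸ c
    t≡n∸c = begin
      t         ≡⟨ m+n∸n≡m t k ⟨
      t + k ∸ k ≡⟨ cong (_∸ k) size ⟩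
      n ∸ k     ≡⟨ cong (n ∸_) (component-count-≡ card L) ⟩
      n ∸ c     ∎
      where open ≡-Reasoning

corollary1p9 : ∀ (n m c : ℕ) (G : Graph n m) →
    Graph.Loopless G →
    HasCardinality (Graph.components G) c →
    IsMaximum (HasGallaiColoringWith G) (n ∸ c)
corollary1p9 n m c G loopless card = gallai-colouring G loopless card , λ _ → colours-≤ G card
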